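{- For all 4-tuples $A,B,C\in V^4$, where $V=\{\text{marked},\text{unmarked}\}$, $$(A\wedge_k B)\wedge_j C=(A\wedge_j C)\wedge_k (B\wedge_j C),$$ where $\wedge_j$ and $\wedge_k$ are the binary operations on $V^4$ $$A\wedge_j B = J^3\big(J(A)\cdot J(B)\big),\qquad A\wedge_k B = K^3\big(K(A)\cdot K(B)\big),$$ with $J(a,b,c,d)=(\bar{c},\bar{d},a,b)$, $K(a,b,c,d)=(\bar{d},c,\bar{b},a)$, and $\cdot$ denoting componentwise juxtaposition.
   Context: In Laws of Form (LoF) an expression takes one of two values, marked or unmarked. Crossing $x\mapsto\bar{x}$ interchanges the two values. Juxtaposition $xy$ of $x,y\in V$ is marked if at least one of $x,y$ is marked and unmarked otherwise (i.e. it is Boolean "or" with marked read as true). On 4-tuples, juxtaposition is componentwise: $(a,b,c,d)\cdot(e,f,g,h)=(ae,bf,cg,dh)$. Powers such as $J^3$ denote iterated composition of the operator with itself. -}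

module Defs where

open import Data.Bool.Base using (Bool; true; false; not; _∨_)
open import Data.Vec.Base using (Vec; []; _∷_; zipWith)
import Function.Endo.Propositional as Endo

-- The two values of the calculus: `true` is read as marked, `false` as
-- unmarked, so that crossing is `not` and juxtaposition is `_∨_`.
V : Set
V = Bool

pattern marked   = true
pattern unmarked = false

cross : V → V
cross = not

V⁴ : Set
V⁴ = Vec V 4

open Endo V⁴ using (_^_)

infixl 7 _·_
_·_ : V⁴ → V⁴ → V⁴
_·_ = zipWith _∨_

J : V⁴ → V⁴
J (a ∷ b ∷ c ∷ d ∷ []) = cross c ∷ cross d ∷ a ∷ b ∷ []

K : V⁴ → V⁴
K (a ∷ b ∷ c ∷ d ∷ []) = cross d ∷ c ∷ cross b ∷ a ∷ []

infix 6 _∧ⱼ_ _∧ₖ_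
_∧ⱼ_ : V⁴ → V⁴ → V⁴
A ∧ⱼ B = (J ^ 3) (J A · J B)

_∧ₖ_ : V⁴ → V⁴ → V⁴
A ∧ₖ B = (K ^ 3) (K A · K B)

{-# OPTIONS --safe #-}
-- J⁴ and K⁴ are the identity, and by De Morgan's laws ∧ⱼ and ∧ₖ act
-- coordinatewise, as (∨ , ∨ , ∧ , ∧) and (∨ , ∧ , ∨ , ∧) respectively.
-- In each coordinate the claim is then right distributivity among ∨ and ∧,
-- where each operation distributes over itself because it is a semilattice.
module Submission where

open import Defs
import Algebra.Properties.IdempotentCommutativeMonoid as IdempotentCommutativeMonoidProperties
open import Data.Bool.Base using (true; false; not; _∧_; _∨_)
open import Data.Bool.Properties
  using ( not-involutive; ∨-distribʳ-∧; ∧-distribʳ-∨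
        ; ∧-idempotentCommutativeMonoid; ∨-idempotentCommutativeMonoid )
open import Data.Vec.Base using ([]; _∷_)
open import Relation.Binary.PropositionalEquality
  using (_≡_; refl; cong₂; module ≡-Reasoning)

-- `_∨_` and `_∧_` compute on their first argument, so splitting on `x` suffices.
not-∨-not : ∀ x y → not (not x ∨ not y) ≡ x ∧ y
not-∨-not true  y = not-involutive y
not-∨-not false y = refl

private
  module ∨ = IdempotentCommutativeMonoidProperties ∨-idempotentCommutativeMonoid
  module ∧ = IdempotentCommutativeMonoidProperties ∧-idempotentCommutativeMonoid

  tuple-cong : ∀ {a b c d a′ b′ c′ d′ : V} → a ≡ a′ → b ≡ b′ → c ≡ c′ → d ≡ d′ →
               _≡_ {A = V⁴} (a ∷ b ∷ c ∷ d ∷ []) (a′ ∷ b′ ∷ c′ ∷ d′ ∷ [])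
  tuple-cong refl refl refl refl = refl

-- Unfolding gives `J ^ 3` as (x, y, z, w) ↦ (`not (not z)`, `not (not w)`, `not x`, `not y`).
-- Coordinates 3 and 4, which `J` crosses, are thus crossed once before and once after joining,
-- giving De Morgan; the other two are only crossed twice afterwards.
∧ⱼ-coordinates : ∀ a b c d e f g h →
  (a ∷ b ∷ c ∷ d ∷ []) ∧ⱼ (e ∷ f ∷ g ∷ h ∷ []) ≡
  (a ∨ e) ∷ (b ∨ f) ∷ (c ∧ g) ∷ (d ∧ h) ∷ []
∧ⱼ-coordinates a b c d e f g h =
  tuple-cong (not-involutive (a ∨ e)) (not-involutive (b ∨ f)) (not-∨-not c g) (not-∨-not d h)

-- The same computation, but `K` crosses coordinates 2 and 4, so the conjunctions appear there.
∧ₖ-coordinates : ∀ a b c d e f g h →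
  (a ∷ b ∷ c ∷ d ∷ []) ∧ₖ (e ∷ f ∷ g ∷ h ∷ []) ≡
  (a ∨ e) ∷ (b ∧ f) ∷ (c ∨ g) ∷ (d ∧ h) ∷ []
∧ₖ-coordinates a b c d e f g h =
  tuple-cong (not-involutive (a ∨ e)) (not-∨-not b f) (not-involutive (c ∨ g)) (not-∨-not d h)

mainTheorem4 : ∀ (A B C : V⁴) → (A ∧ₖ B) ∧ⱼ C ≡ (A ∧ⱼ C) ∧ₖ (B ∧ⱼ C)
mainTheorem4 A@(a₁ ∷ a₂ ∷ a₃ ∷ a₄ ∷ []) B@(b₁ ∷ b₂ ∷ b₃ ∷ b₄ ∷ []) C@(c₁ ∷ c₂ ∷ c₃ ∷ c₄ ∷ []) = begin
  (A ∧ₖ B) ∧ⱼ C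
    ≡⟨ cong₂ _∧ⱼ_ (∧ₖ-coordinates a₁ a₂ a₃ a₄ b₁ b₂ b₃ b₄) refl ⟩
  ((a₁ ∨ b₁) ∷ (a₂ ∧ b₂) ∷ (a₃ ∨ b₃) ∷ (a₄ ∧ b₄) ∷ []) ∧ⱼ C
    ≡⟨ ∧ⱼ-coordinates (a₁ ∨ b₁) (a₂ ∧ b₂) (a₃ ∨ b₃) (a₄ ∧ b₄) c₁ c₂ c₃ c₄ ⟩
  ((a₁ ∨ b₁) ∨ c₁) ∷ ((a₂ ∧ b₂) ∨ c₂) ∷ ((a₃ ∨ b₃) ∧ c₃) ∷ ((a₄ ∧ b₄) ∧ c₄) ∷ []
    -- Each pairing of an outer with an inner operation occurs exactly once: the mixed ones in the
    -- middle, the equal ones at the ends.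
    ≡⟨ tuple-cong (∨.∙-distrʳ-∙ c₁ a₁ b₁)
                  (∨-distribʳ-∧ c₂ a₂ b₂)
                  (∧-distribʳ-∨ c₃ a₃ b₃)
                  (∧.∙-distrʳ-∙ c₄ a₄ b₄) ⟩
  ((a₁ ∨ c₁) ∨ (b₁ ∨ c₁)) ∷ ((a₂ ∨ c₂) ∧ (b₂ ∨ c₂)) ∷
  ((a₃ ∧ c₃) ∨ (b₃ ∧ c₃)) ∷ ((a₄ ∧ c₄) ∧ (b₄ ∧ c₄)) ∷ []
    ≡⟨ ∧ₖ-coordinates (a₁ ∨ c₁) (a₂ ∨ c₂) (a₃ ∧ c₃) (a₄ ∧ c₄)
                      (b₁ ∨ c₁) (b₂ ∨ c₂) (b₃ ∧ c₃) (b₄ ∧ c₄) ⟨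
  ((a₁ ∨ c₁) ∷ (a₂ ∨ c₂) ∷ (a₃ ∧ c₃) ∷ (a₄ ∧ c₄) ∷ []) ∧ₖ
  ((b₁ ∨ c₁) ∷ (b₂ ∨ c₂) ∷ (b₃ ∧ c₃) ∷ (b₄ ∧ c₄) ∷ [])
    ≡⟨ cong₂ _∧ₖ_ (∧ⱼ-coordinates a₁ a₂ a₃ a₄ c₁ c₂ c₃ c₄)
                  (∧ⱼ-coordinates b₁ b₂ b₃ b₄ c₁ c₂ c₃ c₄) ⟨
  (A ∧ⱼ C) ∧ₖ (B ∧ⱼ C) ∎
  where open ≡-Reasoning
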